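{- Let $\sigma$ be a natural number. For every context $\Gamma$ (an arbitrary set of formulas over $\sigma$ propositional letters) and all formulas $p,q$: if $\Gamma\cup\{p\}\vdash_{\mathrm{S5}} q$, then $\Gamma\vdash_{\mathrm{S5}} p\supset q$.
   Context: Fix a natural number $\sigma$. Formulas are generated inductively by: atoms $\#i$ for $i\in\{0,\dots,\sigma-1\}$; the false $\bot$; implications $p\supset q$; and boxed formulas $\Box p$. Abbreviations: $\sim p := p\supset\bot$ and $\Diamond p := \sim\Box\sim p$. A context is an arbitrary (possibly infinite) set of formulas. Proof system. The relation $\Gamma\vdash_{\mathrm{S5}} p$ between contexts and formulas is the inductively defined relation generated by the following rules, for all contexts $\Gamma$ and formulas $p,q,r$: (ax) if $p\in\Gamma$ then $\Gamma\vdash p$; (pl1) $\Gamma\vdash p\supset(q\supset p)$; (pl2) $\Gamma\vdash (p\supset(q\supset r))\supset((p\supset q)\supset(p\supset r))$; (pl3) $\Gamma\vdash (\sim p\supset\sim q)\supset((\sim p\supset q)\supset p)$; (k) $\Gamma\vdash \Box(p\supset q)\supset(\Box p\supset\Box q)$; (t) $\Gamma\vdash \Box p\supset p$; (s4) $\Gamma\vdash \Box p\supset\Box\Box p$; (b) $\Gamma\vdash p\supset\Box\Diamond p$; (mp) if $\Gamma\vdash p\supset q$ and $\Gamma\vdash p$ then $\Gamma\vdash q$; (nec) if $\emptyset\vdash p$ then $\Gamma\vdash\Box p$. -}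

module Defs where

open import Data.Fin using (Fin)
open import Data.Nat using (ℕ)
open import Level using (0ℓ)
open import Relation.Unary using (Pred; _∈_; ∅)

infix  9 #_
infix  8 ∼_ □_ ◇_
infixr 6 _⊃_
infix  3 _⊢S5_

data Formula (σ : ℕ) : Set where
  #_  : Fin σ → Formula σ
  ⊥   : Formula σ
  _⊃_ : Formula σ → Formula σ → Formula σ
  □_  : Formula σ → Formula σ

∼_ : ∀ {σ} → Formula σ → Formula σ
∼ p = p ⊃ ⊥

◇_ : ∀ {σ} → Formula σ → Formula σ
◇ p = ∼ □ ∼ p

-- Membership need not be decidable, and contexts may be infinite.
Context : ℕ → Set₁
Context σ = Pred (Formula σ) 0ℓ

-- The context is a non-uniform parameter: the premise of nec is at ∅, not Γ.
data _⊢S5_ {σ : ℕ} (Γ : Context σ) : Formula σ → Set where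
  ax  : ∀ {p} → p ∈ Γ → Γ ⊢S5 p
  pl1 : ∀ {p q} → Γ ⊢S5 p ⊃ (q ⊃ p)
  pl2 : ∀ {p q r} → Γ ⊢S5 (p ⊃ (q ⊃ r)) ⊃ ((p ⊃ q) ⊃ (p ⊃ r))
  pl3 : ∀ {p q} → Γ ⊢S5 (∼ p ⊃ ∼ q) ⊃ ((∼ p ⊃ q) ⊃ p)
  k   : ∀ {p q} → Γ ⊢S5 □ (p ⊃ q) ⊃ (□ p ⊃ □ q)
  t   : ∀ {p} → Γ ⊢S5 □ p ⊃ p
  s4  : ∀ {p} → Γ ⊢S5 □ p ⊃ □ □ p
  b   : ∀ {p} → Γ ⊢S5 p ⊃ □ ◇ p
  mp  : ∀ {p q} → Γ ⊢S5 p ⊃ q → Γ ⊢S5 p → Γ ⊢S5 q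
  nec : ∀ {p} → ∅ ⊢S5 p → Γ ⊢S5 □ p

module Submission where

open import Defs
open import Data.Nat using (ℕ)
open import Data.Sum using (inj₁; inj₂)
open import Relation.Binary.PropositionalEquality using (refl)
open import Relation.Unary using (_∪_; ｛_｝)

-- Induction on the derivation. Axioms and members of `Γ` are weakened by `pl1`, the hypothesis `p`
-- itself gives `p ⊃ p`, and `pl2` carries modus ponens under `p ⊃_`. Necessitation is harmless
-- because its premise uses no hypotheses.

module _ {σ : ℕ} {Γ : Context σ} where

  ⊃-refl : ∀ {p} → Γ ⊢S5 p ⊃ p
  -- The combinator identity I = SKK; `q = p` fixes the middle formula as `p ⊃ p`, which unification
  -- would leave open.
  ⊃-refl {p} = mp (mp pl2 pl1) (pl1 {q = p})

  ⊃-weaken : ∀ {p q} → Γ ⊢S5 q → Γ ⊢S5 p ⊃ q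
  ⊃-weaken = mp pl1

  deduction : ∀ {p q} → Γ ∪ ｛ p ｝ ⊢S5 q → Γ ⊢S5 p ⊃ q
  deduction (ax (inj₁ q∈Γ))  = ⊃-weaken (ax q∈Γ)
  deduction (ax (inj₂ refl)) = ⊃-refl
  deduction pl1              = ⊃-weaken pl1
  deduction pl2              = ⊃-weaken pl2
  deduction pl3              = ⊃-weaken pl3
  deduction k                = ⊃-weaken k
  deduction t                = ⊃-weaken t
  deduction s4               = ⊃-weaken s4
  deduction b                = ⊃-weaken b
  deduction (mp d e)         = mp (mp pl2 (deduction d)) (deduction e)
  -- No recursive call: `d` lives over `∅`, so `nec` applies to it directly over `Γ`.
  deduction (nec d)          = ⊃-weaken (nec d)

mainTheorem2 : (σ : ℕ) (Γ : Context σ) (p q : Formula σ) →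
    Γ ∪ ｛ p ｝ ⊢S5 q → Γ ⊢S5 p ⊃ q
mainTheorem2 σ Γ p q = deduction
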